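{- Each plain dependent type theory $(\mathbf{ctx},u,\dot u,\Sigma\dashv\Delta)$ produces a comprehension category: the natural transformation $\delta:=u\ast\epsilon:\dot u\Delta=u\Sigma\Delta\Rightarrow u$ (where $\epsilon:\Sigma\Delta\Rightarrow\mathrm{id}$ is the counit) corresponds to a functor $\mathrm{disp}:\mathcal U\to\mathbf{ctx}^{\mathsf 2}$, $A\mapsto(\delta_A:\dot u\Delta A\to uA)$, which satisfies $\mathrm{cod}\circ\mathrm{disp}=u$ and is a comprehension category over the fibration $u$.
   Context: Plain dependent type theory (pDTT): a category $\mathbf{ctx}$ (with terminal object), fibrations $u:\mathcal U\to\mathbf{ctx}$ and $\dot u:\dot{\mathcal U}\to\mathbf{ctx}$, a functor $\Sigma:\dot{\mathcal U}\to\mathcal U$ with $u\Sigma=\dot u$, and a right adjoint $\Delta:\mathcal U\to\dot{\mathcal U}$ of $\Sigma$ (not required to commute with the projections to $\mathbf{ctx}$), with unit $\eta$ and counit $\epsilon$, such that $\Sigma$ and $\Delta$ preserve cartesian morphisms and the components of $\eta$ and $\epsilon$ are cartesian (for $\dot u$ and $u$ respectively). $\mathbf{ctx}^{\mathsf 2}$ is the arrow category. Comprehension category (Jacobs): a fibration $u:\mathcal U\to\mathbf{ctx}$ with a functor $\mathrm{disp}:\mathcal U\to\mathbf{ctx}^{\mathsf 2}$ such that $\mathrm{cod}\circ\mathrm{disp}=u$ and $\mathrm{disp}$ sends $u$-cartesian morphisms to pullback squares in $\mathbf{ctx}$. -}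

module Defs where

open import Level using (Level; _⊔_) renaming (suc to lsuc)
open import Relation.Binary.Core using (Rel)
open import Relation.Binary.Structures using (IsEquivalence)
open import Relation.Binary.PropositionalEquality.Core using (_≡_; refl; sym)

-- Hom-sets are setoids, so every equation between parallel morphisms is
-- stated with _≈_; equality of objects is propositional equality.
record Category (o ℓ e : Level) : Set (lsuc (o ⊔ ℓ ⊔ e)) where
  infix  4 _≈_ _⇒_
  infixr 9 _∘_
  field
    Obj       : Set o
    _⇒_       : Rel Obj ℓ
    _≈_       : ∀ {A B} → Rel (A ⇒ B) e
    id        : ∀ {A} → A ⇒ A
    _∘_       : ∀ {A B C} → B ⇒ C → A ⇒ B → A ⇒ C
    assoc     : ∀ {A B C D} {f : A ⇒ B} {g : B ⇒ C} {h : C ⇒ D} →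
                (h ∘ g) ∘ f ≈ h ∘ (g ∘ f)
    identityˡ : ∀ {A B} {f : A ⇒ B} → id ∘ f ≈ f
    identityʳ : ∀ {A B} {f : A ⇒ B} → f ∘ id ≈ f
    equiv     : ∀ {A B} → IsEquivalence (_≈_ {A} {B})
    ∘-resp-≈  : ∀ {A B C} {f h : B ⇒ C} {g i : A ⇒ B} →
                f ≈ h → g ≈ i → f ∘ g ≈ h ∘ i

  module Equiv {A B : Obj} = IsEquivalence (equiv {A} {B})

  -- The identity morphism, between objects that are equal but need not be
  -- definitionally so.  Strict equations such as uΣ = u̇ are stated with it.
  hid : ∀ {A B} → A ≡ B → A ⇒ B
  hid refl = id

record IsTerminal {o ℓ e} (C : Category o ℓ e) (⊤ : Category.Obj C) : Set (o ⊔ ℓ ⊔ e) where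
  open Category C
  field
    !        : ∀ {A} → A ⇒ ⊤
    !-unique : ∀ {A} (f : A ⇒ ⊤) → ! ≈ f

record Terminal {o ℓ e} (C : Category o ℓ e) : Set (o ⊔ ℓ ⊔ e) where
  field
    ⊤          : Category.Obj C
    isTerminal : IsTerminal C ⊤

record Functor {o ℓ e o′ ℓ′ e′} (C : Category o ℓ e) (D : Category o′ ℓ′ e′) :
               Set (o ⊔ ℓ ⊔ e ⊔ o′ ⊔ ℓ′ ⊔ e′) where
  private
    module C = Category C
    module D = Category D
  field
    F₀           : C.Obj → D.Obj
    F₁           : ∀ {A B} → A C.⇒ B → F₀ A D.⇒ F₀ B
    identity     : ∀ {A} → F₁ (C.id {A}) D.≈ D.id
    homomorphism : ∀ {X Y Z} {f : X C.⇒ Y} {g : Y C.⇒ Z} →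
                   F₁ (g C.∘ f) D.≈ F₁ g D.∘ F₁ f
    F-resp-≈     : ∀ {A B} {f g : A C.⇒ B} → f C.≈ g → F₁ f D.≈ F₁ g

open Functor using (F₀; F₁)

module _ {o ℓ e} {C : Category o ℓ e} where
  open Category C

  idF : Functor C C
  idF = record
    { F₀           = λ A → A
    ; F₁           = λ f → f
    ; identity     = Equiv.refl
    ; homomorphism = Equiv.refl
    ; F-resp-≈     = λ p → p
    }

module _ {o ℓ e o′ ℓ′ e′ o″ ℓ″ e″}
         {C : Category o ℓ e} {D : Category o′ ℓ′ e′} {E : Category o″ ℓ″ e″} where
  private
    module E = Category E

  infixr 9 _∘F_
  _∘F_ : Functor D E → Functor C D → Functor C E
  G ∘F F = record
    { F₀           = λ A → G.F₀ (F.F₀ A)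
    ; F₁           = λ f → G.F₁ (F.F₁ f)
    ; identity     = E.Equiv.trans (G.F-resp-≈ F.identity) G.identity
    ; homomorphism = E.Equiv.trans (G.F-resp-≈ F.homomorphism) G.homomorphism
    ; F-resp-≈     = λ p → G.F-resp-≈ (F.F-resp-≈ p)
    }
    where
      module F = Functor F
      module G = Functor G

-- Strict equality of functors: equal on objects and, modulo the resulting
-- identifications of source and target, equal on morphisms.
infix 4 _≡F_
record _≡F_ {o ℓ e o′ ℓ′ e′} {C : Category o ℓ e} {D : Category o′ ℓ′ e′}
            (F G : Functor C D) : Set (o ⊔ ℓ ⊔ e ⊔ o′ ⊔ ℓ′ ⊔ e′) where
  private
    module C = Category C
  open Category D
  field
    eq₀ : ∀ X → F₀ F X ≡ F₀ G X
    eq₁ : ∀ {X Y} (f : X C.⇒ Y) →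
          hid (eq₀ Y) ∘ F₁ F f ≈ F₁ G f ∘ hid (eq₀ X)

record NaturalTransformation {o ℓ e o′ ℓ′ e′}
                             {C : Category o ℓ e} {D : Category o′ ℓ′ e′}
                             (F G : Functor C D) : Set (o ⊔ ℓ ⊔ e ⊔ o′ ⊔ ℓ′ ⊔ e′) where
  private
    module C = Category C
  open Category D
  field
    η       : ∀ X → F₀ F X ⇒ F₀ G X
    commute : ∀ {X Y} (f : X C.⇒ Y) → η Y ∘ F₁ F f ≈ F₁ G f ∘ η X

module _ {o ℓ e o′ ℓ′ e′} {C : Category o ℓ e} {D : Category o′ ℓ′ e′} where
  open Category D

  infixr 9 _∘ᵥ_
  _∘ᵥ_ : {F G H : Functor C D} →
         NaturalTransformation G H → NaturalTransformation F G → NaturalTransformation F H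
  β ∘ᵥ α = record
    { η       = λ X → β.η X ∘ α.η X
    ; commute = λ f →
        Equiv.trans assoc
        (Equiv.trans (∘-resp-≈ Equiv.refl (α.commute f))
        (Equiv.trans (Equiv.sym assoc)
        (Equiv.trans (∘-resp-≈ (β.commute f) Equiv.refl)
         assoc)))
    }
    where
      module α = NaturalTransformation α
      module β = NaturalTransformation β

  private
    hid-transpose : ∀ {A A′ B B′} (p : A ≡ A′) (q : B ≡ B′) {f : A ⇒ B} {g : A′ ⇒ B′} →
                    hid q ∘ f ≈ g ∘ hid p → hid (sym q) ∘ g ≈ f ∘ hid (sym p)
    hid-transpose refl refl s =
      Equiv.trans identityˡ
      (Equiv.trans (Equiv.sym identityʳ)
      (Equiv.trans (Equiv.sym s)
      (Equiv.trans identityˡ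
       (Equiv.sym identityʳ))))

  ≡F-sym : {F G : Functor C D} → F ≡F G → G ≡F F
  ≡F-sym F≡G = record
    { eq₀ = λ X → sym (eq₀ X)
    ; eq₁ = λ {X} {Y} f → hid-transpose (eq₀ X) (eq₀ Y) (eq₁ f)
    }
    where open _≡F_ F≡G

  ≡F⇒natural : {F G : Functor C D} → F ≡F G → NaturalTransformation F G
  ≡F⇒natural F≡G = record { η = λ X → hid (eq₀ X) ; commute = eq₁ }
    where open _≡F_ F≡G

module _ {o ℓ e o′ ℓ′ e′ o″ ℓ″ e″}
         {C : Category o ℓ e} {D : Category o′ ℓ′ e′} {E : Category o″ ℓ″ e″} where
  private
    module E = Category E

  infixr 9 _*ˡ_
  infixl 9 _*ʳ_

  _*ˡ_ : {F G : Functor C D} (H : Functor D E) →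
         NaturalTransformation F G → NaturalTransformation (H ∘F F) (H ∘F G)
  H *ˡ α = record
    { η       = λ X → H.F₁ (α.η X)
    ; commute = λ f →
        E.Equiv.trans (E.Equiv.sym H.homomorphism)
        (E.Equiv.trans (H.F-resp-≈ (α.commute f))
         H.homomorphism)
    }
    where
      module H = Functor H
      module α = NaturalTransformation α

  _*ʳ_ : {F G : Functor D E} →
         NaturalTransformation F G → (K : Functor C D) →
         NaturalTransformation (F ∘F K) (G ∘F K)
  α *ʳ K = record
    { η       = λ X → α.η (F₀ K X)
    ; commute = λ f → α.commute (F₁ K f)
    }
    where module α = NaturalTransformation α

record Adjoint {o ℓ e o′ ℓ′ e′} {C : Category o ℓ e} {D : Category o′ ℓ′ e′}
               (L : Functor C D) (R : Functor D C) :
               Set (o ⊔ ℓ ⊔ e ⊔ o′ ⊔ ℓ′ ⊔ e′) where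
  private
    module C = Category C
    module D = Category D
  field
    unit   : NaturalTransformation idF (R ∘F L)
    counit : NaturalTransformation (L ∘F R) idF

  module unit   = NaturalTransformation unit
  module counit = NaturalTransformation counit

  field
    zig : ∀ {A} → counit.η (F₀ L A) D.∘ F₁ L (unit.η A) D.≈ D.id
    zag : ∀ {B} → F₁ R (counit.η B) C.∘ unit.η (F₀ R B) C.≈ C.id

module _ {o ℓ e o′ ℓ′ e′} {E : Category o ℓ e} {B : Category o′ ℓ′ e′} (p : Functor E B) where
  private
    module E = Category E
    module B = Category B
    module p = Functor p

  record IsCartesian {X Y} (φ : X E.⇒ Y) : Set (o ⊔ ℓ ⊔ e ⊔ ℓ′ ⊔ e′) where
    field
      factor : ∀ {Z} (ψ : Z E.⇒ Y) (h : p.F₀ Z B.⇒ p.F₀ X) →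
               p.F₁ φ B.∘ h B.≈ p.F₁ ψ → Z E.⇒ X
      factor-over : ∀ {Z} {ψ : Z E.⇒ Y} {h : p.F₀ Z B.⇒ p.F₀ X}
                    (eq : p.F₁ φ B.∘ h B.≈ p.F₁ ψ) →
                    p.F₁ (factor ψ h eq) B.≈ h
      factor-commutes : ∀ {Z} {ψ : Z E.⇒ Y} {h : p.F₀ Z B.⇒ p.F₀ X}
                        (eq : p.F₁ φ B.∘ h B.≈ p.F₁ ψ) →
                        φ E.∘ factor ψ h eq E.≈ ψ
      factor-unique : ∀ {Z} {ψ : Z E.⇒ Y} {h : p.F₀ Z B.⇒ p.F₀ X}
                      (eq : p.F₁ φ B.∘ h B.≈ p.F₁ ψ) {χ : Z E.⇒ X} →
                      p.F₁ χ B.≈ h → φ E.∘ χ E.≈ ψ → χ E.≈ factor ψ h eq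

  record CartesianLift {I} (Y : E.Obj) (f : I B.⇒ p.F₀ Y) : Set (o ⊔ ℓ ⊔ e ⊔ o′ ⊔ ℓ′ ⊔ e′) where
    field
      obj         : E.Obj
      obj-over    : p.F₀ obj ≡ I
      arrow       : obj E.⇒ Y
      arrow-over  : p.F₁ arrow B.≈ f B.∘ B.hid obj-over
      isCartesian : IsCartesian arrow

  IsFibration : Set (o ⊔ ℓ ⊔ e ⊔ o′ ⊔ ℓ′ ⊔ e′)
  IsFibration = ∀ {I} (Y : E.Obj) (f : I B.⇒ p.F₀ Y) → CartesianLift Y f

module _ {o ℓ e} (C : Category o ℓ e) where
  open Category C

  record Arrow : Set (o ⊔ ℓ) where
    constructor arrow
    field
      {dom} : Obj
      {cod} : Obj
      arr   : dom ⇒ cod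

  record Square (f g : Arrow) : Set (ℓ ⊔ e) where
    private
      module f = Arrow f
      module g = Arrow g
    field
      top      : f.dom ⇒ g.dom
      bottom   : f.cod ⇒ g.cod
      commutes : g.arr ∘ top ≈ bottom ∘ f.arr

module _ {o ℓ e} {C : Category o ℓ e} where
  open Category C

  record _≈□_ {f g : Arrow C} (s t : Square C f g) : Set e where
    constructor _,_
    private
      module s = Square s
      module t = Square t
    field
      top-≈    : s.top ≈ t.top
      bottom-≈ : s.bottom ≈ t.bottom

  -- The square S, with legs S.top and f out of the corner dom f.
  record IsPullback {f g : Arrow C} (S : Square C f g) : Set (o ⊔ ℓ ⊔ e) where
    private
      module f = Arrow f
      module g = Arrow g
      module S = Square S
    field
      universal : ∀ {X} (x : X ⇒ g.dom) (y : X ⇒ f.cod) →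
                  g.arr ∘ x ≈ S.bottom ∘ y → X ⇒ f.dom
      universal-top : ∀ {X} {x : X ⇒ g.dom} {y : X ⇒ f.cod}
                      (eq : g.arr ∘ x ≈ S.bottom ∘ y) →
                      S.top ∘ universal x y eq ≈ x
      universal-arr : ∀ {X} {x : X ⇒ g.dom} {y : X ⇒ f.cod}
                      (eq : g.arr ∘ x ≈ S.bottom ∘ y) →
                      f.arr ∘ universal x y eq ≈ y
      universal-unique : ∀ {X} {x : X ⇒ g.dom} {y : X ⇒ f.cod}
                         (eq : g.arr ∘ x ≈ S.bottom ∘ y) {z : X ⇒ f.dom} →
                         S.top ∘ z ≈ x → f.arr ∘ z ≈ y → z ≈ universal x y eq

infix 10 _^𝟚
_^𝟚 : ∀ {o ℓ e} → Category o ℓ e → Category (o ⊔ ℓ) (ℓ ⊔ e) e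
C ^𝟚 = record
  { Obj       = Arrow C
  ; _⇒_       = Square C
  ; _≈_       = _≈□_
  ; id        = record
    { top      = id
    ; bottom   = id
    ; commutes = Equiv.trans identityʳ (Equiv.sym identityˡ)
    }
  ; _∘_       = λ t s → record
    { top      = Square.top t ∘ Square.top s
    ; bottom   = Square.bottom t ∘ Square.bottom s
    ; commutes =
        Equiv.trans (Equiv.sym assoc)
        (Equiv.trans (∘-resp-≈ (Square.commutes t) Equiv.refl)
        (Equiv.trans assoc
        (Equiv.trans (∘-resp-≈ Equiv.refl (Square.commutes s))
         (Equiv.sym assoc))))
    }
  ; assoc     = assoc , assoc
  ; identityˡ = identityˡ , identityˡ
  ; identityʳ = identityʳ , identityʳ
  ; equiv     = record
    { refl  = Equiv.refl , Equiv.refl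
    ; sym   = λ (p , q) → Equiv.sym p , Equiv.sym q
    ; trans = λ (p , q) (r , s) → Equiv.trans p r , Equiv.trans q s
    }
  ; ∘-resp-≈  = λ (p , q) (r , s) → ∘-resp-≈ p r , ∘-resp-≈ q s
  }
  where open Category C

module _ {o ℓ e} {C : Category o ℓ e} where
  open Category C

  domF : Functor (C ^𝟚) C
  domF = record
    { F₀           = Arrow.dom
    ; F₁           = Square.top
    ; identity     = Equiv.refl
    ; homomorphism = Equiv.refl
    ; F-resp-≈     = _≈□_.top-≈
    }

  codF : Functor (C ^𝟚) C
  codF = record
    { F₀           = Arrow.cod
    ; F₁           = Square.bottom
    ; identity     = Equiv.refl
    ; homomorphism = Equiv.refl
    ; F-resp-≈     = _≈□_.bottom-≈
    }

-- The correspondence between natural transformations α : F ⇒ G and functors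
-- T : C → D^𝟚 with dom ∘ T = F and cod ∘ T = G, whose object part is X ↦ α_X.
-- A square is determined by its top and bottom sides, so dom-≡ and cod-≡
-- describe T on morphisms.
record Corresponds {o ℓ e o′ ℓ′ e′} {C : Category o ℓ e} {D : Category o′ ℓ′ e′}
                   {F G : Functor C D} (α : NaturalTransformation F G)
                   (T : Functor C (D ^𝟚)) : Set (o ⊔ ℓ ⊔ e ⊔ o′ ⊔ ℓ′ ⊔ e′) where
  field
    obj-≡ : ∀ X → F₀ T X ≡ arrow (NaturalTransformation.η α X)
    dom-≡ : domF ∘F T ≡F F
    cod-≡ : codF ∘F T ≡F G

record IsComprehensionCategory {o ℓ e o′ ℓ′ e′} {𝒰 : Category o ℓ e} {ctx : Category o′ ℓ′ e′}
                               (u : Functor 𝒰 ctx) (disp : Functor 𝒰 (ctx ^𝟚)) :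
                               Set (o ⊔ ℓ ⊔ e ⊔ o′ ⊔ ℓ′ ⊔ e′) where
  open Category 𝒰
  field
    isFibration        : IsFibration u
    cod∘disp           : codF ∘F disp ≡F u
    cartesian⇒pullback : ∀ {A B} (φ : A ⇒ B) → IsCartesian u φ → IsPullback (F₁ disp φ)

record PlainDTT (o ℓ e o₁ ℓ₁ e₁ o₂ ℓ₂ e₂ : Level) :
                Set (lsuc (o ⊔ ℓ ⊔ e ⊔ o₁ ⊔ ℓ₁ ⊔ e₁ ⊔ o₂ ⊔ ℓ₂ ⊔ e₂)) where
  field
    ctx      : Category o ℓ e
    terminal : Terminal ctx
    𝒰        : Category o₁ ℓ₁ e₁
    𝒰̇        : Category o₂ ℓ₂ e₂
    u        : Functor 𝒰 ctx
    u̇        : Functor 𝒰̇ ctx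
    u-fib    : IsFibration u
    u̇-fib    : IsFibration u̇
    Σ        : Functor 𝒰̇ 𝒰
    uΣ≡u̇     : u ∘F Σ ≡F u̇
    Δ        : Functor 𝒰 𝒰̇
    Σ⊣Δ      : Adjoint Σ Δ

  open Adjoint Σ⊣Δ public using () renaming (unit to η; counit to ε)

  private
    module 𝒰 = Category 𝒰
    module 𝒰̇ = Category 𝒰̇

  field
    Σ-cartesian : ∀ {a b} (φ : a 𝒰̇.⇒ b) → IsCartesian u̇ φ → IsCartesian u (F₁ Σ φ)
    Δ-cartesian : ∀ {A B} (φ : A 𝒰.⇒ B) → IsCartesian u φ → IsCartesian u̇ (F₁ Δ φ)
    η-cartesian : ∀ a → IsCartesian u̇ (η.η a)
    ε-cartesian : ∀ A → IsCartesian u (ε.η A)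

  -- u * ε, precomposed with the identification u̇Δ = uΣΔ.  The functors
  -- (u ∘F Σ) ∘F Δ and u ∘F (Σ ∘F Δ) agree definitionally on objects and
  -- morphisms, but not in their proofs of the functor laws.
  δ : NaturalTransformation (u̇ ∘F Δ) u
  δ = u*ε ∘ᵥ (≡F⇒natural (≡F-sym uΣ≡u̇) *ʳ Δ)
    where
      u*ε : NaturalTransformation ((u ∘F Σ) ∘F Δ) u
      u*ε = record { NaturalTransformation (u *ˡ ε) }

{-# OPTIONS --safe #-}
-- To complete x : X → u̇ΔB and y : X → uA with δ_B x = uφ y, lift x to a cartesian χ : b → ΔB.
-- Its transpose Σb → B lies over uφ y, so it factors through the cartesian φ by some Σb → A
-- over y, whose transpose b → ΔA lies over the required X → u̇ΔA.  For uniqueness, any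
-- competitor lifts along the cartesian Δφ to some b → ΔA, and its transpose is that same factor.
module Submission where

open import Level using (_⊔_)
open import Data.Product using (_×_; ∃; _,_)
open import Relation.Binary.Bundles using (Setoid)
open import Relation.Binary.PropositionalEquality.Core using (_≡_; refl; sym)
import Relation.Binary.Reasoning.Setoid as SetoidReasoning
open import Defs

open Functor using (F₀; F₁)

module HomReasoning {o ℓ e} (C : Category o ℓ e) where
  open Category C
  open Equiv public using () renaming (refl to ≈-refl; sym to ≈-sym; trans to ≈-trans)

  homSetoid : (A B : Obj) → Setoid ℓ e
  homSetoid A B = record { Carrier = A ⇒ B ; _≈_ = _≈_ ; isEquivalence = equiv }

  module _ {A B : Obj} where
    open SetoidReasoning (homSetoid A B) public

  infixr 4 refl⟩∘⟨_
  infixl 5 _⟩∘⟨refl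

  refl⟩∘⟨_ : ∀ {A B D} {f : B ⇒ D} {g h : A ⇒ B} → g ≈ h → f ∘ g ≈ f ∘ h
  refl⟩∘⟨_ = ∘-resp-≈ ≈-refl

  _⟩∘⟨refl : ∀ {A B D} {f g : B ⇒ D} {h : A ⇒ B} → f ≈ g → f ∘ h ≈ g ∘ h
  p ⟩∘⟨refl = ∘-resp-≈ p ≈-refl

  cancelʳ : ∀ {A B D} {f : B ⇒ D} {g : A ⇒ B} {h : B ⇒ A} → g ∘ h ≈ id → (f ∘ g) ∘ h ≈ f
  cancelʳ p = ≈-trans assoc (≈-trans (refl⟩∘⟨ p) identityʳ)

  hid-sym-∘ : ∀ {A B} (p : A ≡ B) → hid (sym p) ∘ hid p ≈ id
  hid-sym-∘ refl = identityˡ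

  hid-∘-sym : ∀ {A B} (p : A ≡ B) → hid p ∘ hid (sym p) ≈ id
  hid-∘-sym refl = identityˡ

module Transpose {o ℓ e o′ ℓ′ e′} {C : Category o ℓ e} {D : Category o′ ℓ′ e′}
                 {L : Functor C D} {R : Functor D C} (L⊣R : Adjoint L R) where
  private
    module C = Category C
    module D = Category D
    module L = Functor L
    module R = Functor R
    module RC = HomReasoning C
    module RD = HomReasoning D
  open Adjoint L⊣R

  -- The adjunction in hom-set form: `♯` and `♭` are the two directions of transposition, proved
  -- mutually inverse below.
  ♯ : ∀ {X Y} → X C.⇒ R.F₀ Y → L.F₀ X D.⇒ Y
  ♯ g = counit.η _ D.∘ L.F₁ g

  ♭ : ∀ {X Y} → L.F₀ X D.⇒ Y → X C.⇒ R.F₀ Y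
  ♭ f = R.F₁ f C.∘ unit.η _

  ♯-resp-≈ : ∀ {X Y} {g h : X C.⇒ R.F₀ Y} → g C.≈ h → ♯ g D.≈ ♯ h
  ♯-resp-≈ p = RD.refl⟩∘⟨ L.F-resp-≈ p

  ♭-resp-≈ : ∀ {X Y} {f h : L.F₀ X D.⇒ Y} → f D.≈ h → ♭ f C.≈ ♭ h
  ♭-resp-≈ p = R.F-resp-≈ p RC.⟩∘⟨refl

  ♯-natural : ∀ {X Y Z} {f : Y D.⇒ Z} {g : X C.⇒ R.F₀ Y} → ♯ (R.F₁ f C.∘ g) D.≈ f D.∘ ♯ g
  ♯-natural {f = f} {g} = begin
    counit.η _ D.∘ L.F₁ (R.F₁ f C.∘ g)        ≈⟨ refl⟩∘⟨ L.homomorphism ⟩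
    counit.η _ D.∘ L.F₁ (R.F₁ f) D.∘ L.F₁ g   ≈⟨ D.assoc ⟨
    (counit.η _ D.∘ L.F₁ (R.F₁ f)) D.∘ L.F₁ g ≈⟨ counit.commute f ⟩∘⟨refl ⟩
    (f D.∘ counit.η _) D.∘ L.F₁ g             ≈⟨ D.assoc ⟩
    f D.∘ ♯ g                                 ∎
    where open RD

  ♭-natural : ∀ {X Y Z} {f : Y D.⇒ Z} {g : L.F₀ X D.⇒ Y} → ♭ (f D.∘ g) C.≈ R.F₁ f C.∘ ♭ g
  ♭-natural = RC.≈-trans (R.homomorphism RC.⟩∘⟨refl) C.assoc

  -- `♭ f` is `R.F₁ f` after the unit, so `♯-natural` pulls `f` out and leaves the triangle identity
  -- `zig`.
  ♯∘♭ : ∀ {X Y} {f : L.F₀ X D.⇒ Y} → ♯ (♭ f) D.≈ f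
  ♯∘♭ {f = f} = begin
    ♯ (R.F₁ f C.∘ unit.η _) ≈⟨ ♯-natural ⟩
    f D.∘ ♯ (unit.η _)      ≈⟨ refl⟩∘⟨ zig ⟩
    f D.∘ D.id              ≈⟨ D.identityʳ ⟩
    f                       ∎
    where open RD

  -- Dually, naturality of the unit moves `g` to the right and exposes `zag`.
  ♭∘♯ : ∀ {X Y} {g : X C.⇒ R.F₀ Y} → ♭ (♯ g) C.≈ g
  ♭∘♯ {g = g} = begin
    ♭ (counit.η _ D.∘ L.F₁ g)                 ≈⟨ ♭-natural ⟩
    R.F₁ (counit.η _) C.∘ ♭ (L.F₁ g)          ≈⟨ refl⟩∘⟨ unit.commute g ⟨
    R.F₁ (counit.η _) C.∘ unit.η _ C.∘ g      ≈⟨ C.assoc ⟨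
    (R.F₁ (counit.η _) C.∘ unit.η _) C.∘ g    ≈⟨ zag ⟩∘⟨refl ⟩
    C.id C.∘ g                                ≈⟨ C.identityˡ ⟩
    g                                         ∎
    where open RC

module _ {o ℓ e o′ ℓ′ e′} {C : Category o ℓ e} {D : Category o′ ℓ′ e′} where
  open Category D

  module _ {F G : Functor C D} (α : NaturalTransformation F G) where
    open NaturalTransformation α
    open HomReasoning D
    private
      module F = Functor F
      module G = Functor G

    toArrowFunctor : Functor C (D ^𝟚)
    toArrowFunctor = record
      { F₀           = λ X → arrow (η X)
      ; F₁           = λ f → record { top = F.F₁ f ; bottom = G.F₁ f ; commutes = commute f }
      ; identity     = F.identity , G.identity
      ; homomorphism = F.homomorphism , G.homomorphism
      ; F-resp-≈     = λ p → F.F-resp-≈ p , G.F-resp-≈ p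
      }

    -- The object parts agree definitionally, so each `hid` is an identity and only unit laws
    -- remain.
    toArrowFunctor-corresponds : Corresponds α toArrowFunctor
    toArrowFunctor-corresponds = record
      { obj-≡ = λ _ → refl
      ; dom-≡ = record { eq₀ = λ _ → refl ; eq₁ = λ _ → ≈-trans identityˡ (≈-sym identityʳ) }
      ; cod-≡ = record { eq₀ = λ _ → refl ; eq₁ = λ _ → ≈-trans identityˡ (≈-sym identityʳ) }
      }

module _ {o ℓ e o₁ ℓ₁ e₁ o₂ ℓ₂ e₂} (T : PlainDTT o ℓ e o₁ ℓ₁ e₁ o₂ ℓ₂ e₂) where
  open PlainDTT T
  open Category ctx
  open HomReasoning ctx
  open Transpose Σ⊣Δ
  private
    module 𝒰 = Category 𝒰
    module 𝒰̇ = Category 𝒰̇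
    module R𝒰 = HomReasoning 𝒰
    module R𝒰̇ = HomReasoning 𝒰̇
    module u = Functor u
    module u̇ = Functor u̇
    module Σ = Functor Σ
    module Δ = Functor Δ
    module δ = NaturalTransformation δ
    open _≡F_ uΣ≡u̇ using (eq₀)

    -- `uΣ≡u̇` identifies objects only propositionally; `ι` and its inverse `κ` carry that
    -- identification as arrows of `ctx`.
    ι : ∀ b → u̇.F₀ b ⇒ u.F₀ (Σ.F₀ b)
    ι b = hid (sym (eq₀ b))

    κ : ∀ b → u.F₀ (Σ.F₀ b) ⇒ u̇.F₀ b
    κ b = hid (eq₀ b)

  -- The bridge from `ctx` to `𝒰`: `δ` is `u` of the counit after `ι`, and naturality of `ι` moves
  -- it past `u̇.F₁ g`, so that counit and `Σ.F₁ g` combine into a transpose.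
  δ-transpose : ∀ {b A} (g : b 𝒰̇.⇒ Δ.F₀ A) → δ.η A ∘ u̇.F₁ g ≈ u.F₁ (♯ g) ∘ ι b
  δ-transpose {b} {A} g = begin
    (u.F₁ (ε.η A) ∘ ι (Δ.F₀ A)) ∘ u̇.F₁ g    ≈⟨ assoc ⟩
    u.F₁ (ε.η A) ∘ ι (Δ.F₀ A) ∘ u̇.F₁ g      ≈⟨ refl⟩∘⟨ _≡F_.eq₁ (≡F-sym uΣ≡u̇) g ⟩
    u.F₁ (ε.η A) ∘ u.F₁ (Σ.F₁ g) ∘ ι b      ≈⟨ assoc ⟨
    (u.F₁ (ε.η A) ∘ u.F₁ (Σ.F₁ g)) ∘ ι b    ≈⟨ u.homomorphism ⟩∘⟨refl ⟨
    u.F₁ (♯ g) ∘ ι b                        ∎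

  δ-transpose⁻¹ : ∀ {b A} (g : b 𝒰̇.⇒ Δ.F₀ A) → (δ.η A ∘ u̇.F₁ g) ∘ κ b ≈ u.F₁ (♯ g)
  δ-transpose⁻¹ {b} g = ≈-trans (δ-transpose g ⟩∘⟨refl) (cancelʳ (hid-sym-∘ (eq₀ b)))

  module _ {A B} (φ : A 𝒰.⇒ B) (φ-cart : IsCartesian u φ) where
    private
      module φ = IsCartesian φ-cart
      module Δφ = IsCartesian (Δ-cartesian φ φ-cart)

    -- The universal property at a single cone, bundled so that one construction supplies all four
    -- fields of `IsPullback`.
    record Mediator {X} (x : X ⇒ u̇.F₀ (Δ.F₀ B)) (y : X ⇒ u.F₀ A) : Set (ℓ ⊔ e) where
      field
        universal : X ⇒ u̇.F₀ (Δ.F₀ A)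
        top       : u̇.F₁ (Δ.F₁ φ) ∘ universal ≈ x
        arr       : δ.η A ∘ universal ≈ y
        unique    : ∀ {z} → u̇.F₁ (Δ.F₁ φ) ∘ z ≈ x → δ.η A ∘ z ≈ y → z ≈ universal

    module _ {b} (χ : b 𝒰̇.⇒ Δ.F₀ B) {x : u̇.F₀ b ⇒ u̇.F₀ (Δ.F₀ B)} (χ-over : u̇.F₁ χ ≈ x)
             {y : u̇.F₀ b ⇒ u.F₀ A} (eq : δ.η B ∘ x ≈ u.F₁ φ ∘ y) where

      -- This is what allows `♯ χ` to be factored through the cartesian `φ` over `y ∘ κ b`.
      transpose-over : u.F₁ φ ∘ (y ∘ κ b) ≈ u.F₁ (♯ χ)
      transpose-over = begin
        u.F₁ φ ∘ (y ∘ κ b)        ≈⟨ assoc ⟨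
        (u.F₁ φ ∘ y) ∘ κ b        ≈⟨ eq ⟩∘⟨refl ⟨
        (δ.η B ∘ x) ∘ κ b         ≈⟨ (refl⟩∘⟨ χ-over) ⟩∘⟨refl ⟨
        (δ.η B ∘ u̇.F₁ χ) ∘ κ b    ≈⟨ δ-transpose⁻¹ χ ⟩
        u.F₁ (♯ χ)                ∎

      private
        ψ : Σ.F₀ b 𝒰.⇒ A
        ψ = φ.factor (♯ χ) (y ∘ κ b) transpose-over

      mediator-over : Mediator x y
      mediator-over = record
        { universal = u̇.F₁ (♭ ψ)
        ; top       = begin
            u̇.F₁ (Δ.F₁ φ) ∘ u̇.F₁ (♭ ψ)  ≈⟨ u̇.homomorphism ⟨
            u̇.F₁ (Δ.F₁ φ 𝒰̇.∘ ♭ ψ)       ≈⟨ u̇.F-resp-≈ Δφ∘♭ψ ⟩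
            u̇.F₁ χ                      ≈⟨ χ-over ⟩
            x                           ∎
        ; arr       = begin
            δ.η A ∘ u̇.F₁ (♭ ψ)          ≈⟨ δ-transpose (♭ ψ) ⟩
            u.F₁ (♯ (♭ ψ)) ∘ ι b        ≈⟨ u.F-resp-≈ ♯∘♭ ⟩∘⟨refl ⟩
            u.F₁ ψ ∘ ι b                ≈⟨ φ.factor-over transpose-over ⟩∘⟨refl ⟩
            (y ∘ κ b) ∘ ι b             ≈⟨ cancelʳ (hid-∘-sym (eq₀ b)) ⟩
            y                           ∎
        ; unique    = unique
        }
        where
        -- The transpose of the factorisation of `♯ χ` as `φ` after `ψ`.
        Δφ∘♭ψ : Δ.F₁ φ 𝒰̇.∘ ♭ ψ 𝒰̇.≈ χ
        Δφ∘♭ψ = R𝒰̇.begin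
          Δ.F₁ φ 𝒰̇.∘ ♭ ψ  R𝒰̇.≈⟨ ♭-natural ⟨
          ♭ (φ 𝒰.∘ ψ)     R𝒰̇.≈⟨ ♭-resp-≈ (φ.factor-commutes transpose-over) ⟩
          ♭ (♯ χ)         R𝒰̇.≈⟨ ♭∘♯ ⟩
          χ               R𝒰̇.∎

        unique : ∀ {z} → u̇.F₁ (Δ.F₁ φ) ∘ z ≈ x → δ.η A ∘ z ≈ y → z ≈ u̇.F₁ (♭ ψ)
        unique {z} z-top z-arr = begin
          z               ≈⟨ Δφ.factor-over z-over ⟨
          u̇.F₁ ω          ≈⟨ u̇.F-resp-≈ ♭∘♯ ⟨
          u̇.F₁ (♭ (♯ ω))  ≈⟨ u̇.F-resp-≈ (♭-resp-≈ ♯ω≈ψ) ⟩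
          u̇.F₁ (♭ ψ)      ∎
          where
          z-over : u̇.F₁ (Δ.F₁ φ) ∘ z ≈ u̇.F₁ χ
          z-over = ≈-trans z-top (≈-sym χ-over)

          -- `z` lives in `ctx` and has no transpose; its lift `ω` through the cartesian `Δ.F₁ φ`
          -- does.
          ω : b 𝒰̇.⇒ Δ.F₀ A
          ω = Δφ.factor χ z z-over

          ♯ω-over : u.F₁ (♯ ω) ≈ y ∘ κ b
          ♯ω-over = begin
            u.F₁ (♯ ω)              ≈⟨ δ-transpose⁻¹ ω ⟨
            (δ.η A ∘ u̇.F₁ ω) ∘ κ b  ≈⟨ (refl⟩∘⟨ Δφ.factor-over z-over) ⟩∘⟨refl ⟩
            (δ.η A ∘ z) ∘ κ b       ≈⟨ z-arr ⟩∘⟨refl ⟩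
            y ∘ κ b                 ∎

          ♯ω≈ψ : ♯ ω 𝒰.≈ ψ
          ♯ω≈ψ = φ.factor-unique transpose-over ♯ω-over
            -- By naturality, `φ` after `♯ ω` is the transpose of `Δ.F₁ φ` after `ω`, which is `χ`.
            (R𝒰.≈-trans (R𝒰.≈-sym ♯-natural) (♯-resp-≈ (Δφ.factor-commutes z-over)))

    mediator : ∀ {X} {x : X ⇒ u̇.F₀ (Δ.F₀ B)} {y : X ⇒ u.F₀ A} → CartesianLift u̇ (Δ.F₀ B) x →
               δ.η B ∘ x ≈ u.F₁ φ ∘ y → Mediator x y
    -- Matching `obj-over` with `refl` turns the arbitrary corner `X` into the base `u̇.F₀ b` of the
    -- lifted object; the `hid` in `arrow-over` becomes an identity, removed by `identityʳ`. The
    -- match requires `X` to be a variable, so the lift is passed as an argument.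
    mediator record { obj-over = refl ; arrow = χ ; arrow-over = χ-over } =
      mediator-over χ (≈-trans χ-over identityʳ)

    δ-pullback : IsPullback (F₁ (toArrowFunctor δ) φ)
    δ-pullback = record
      { universal        = λ x y eq → Mediator.universal (mediate eq)
      ; universal-top    = λ eq → Mediator.top (mediate eq)
      ; universal-arr    = λ eq → Mediator.arr (mediate eq)
      ; universal-unique = λ eq → Mediator.unique (mediate eq)
      }
      where
      mediate : ∀ {X} {x : X ⇒ u̇.F₀ (Δ.F₀ B)} {y : X ⇒ u.F₀ A} →
                δ.η B ∘ x ≈ u.F₁ φ ∘ y → Mediator x y
      mediate {x = x} = mediator (u̇-fib (Δ.F₀ B) x)

mainTheorem6 : ∀ {o ℓ e o₁ ℓ₁ e₁ o₂ ℓ₂ e₂} (T : PlainDTT o ℓ e o₁ ℓ₁ e₁ o₂ ℓ₂ e₂) →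
    let open PlainDTT T in
    ∃ λ (disp : Functor 𝒰 (ctx ^𝟚)) →
    Corresponds δ disp × IsComprehensionCategory u disp
mainTheorem6 T = toArrowFunctor δ , toArrowFunctor-corresponds δ , record
  { isFibration        = u-fib
  ; cod∘disp           = Corresponds.cod-≡ (toArrowFunctor-corresponds δ)
  ; cartesian⇒pullback = δ-pullback T
  }
  where open PlainDTT T
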